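{- Let $k\ge 1$ be an integer and let $X$ be a finite simple graph in which every odd cycle has length at least $2k+1$, and let $\chi$ be the chromatic number of $X$. Then the number of vertices of $X$ is at least \[ 2\binom{k-1 + \lfloor \frac{\chi-1}{2}\rfloor}{k-1} + \binom{k - 1 + \lfloor \frac{\chi-1}{2}\rfloor}{k} - 1. \]
   Context: The chromatic number of a graph is the minimum number of colors in a proper vertex coloring (adjacent vertices receive different colors). Binomial coefficients $\binom{a}{b}$ with $b>a\ge 0$ are $0$. -}

module Defs where

open import Data.Nat using (ℕ; zero; suc; _+_; _*_; _∸_; _≤_; _%_; _/_)
open import Data.Nat.Combinatorics using (_C_)
open import Data.Fin using (Fin; inject₁; fromℕ) renaming (zero to fzero; suc to fsuc)
open import Data.Bool using (Bool; true; false)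
open import Data.Product using (Σ; _×_)
open import Function.Definitions using (Injective)
open import Relation.Binary.PropositionalEquality using (_≡_; _≢_)

record SimpleGraph (n : ℕ) : Set where
  field
    adj    : Fin n → Fin n → Bool
    sym    : ∀ u v → adj u v ≡ adj v u
    irrefl : ∀ v → adj v v ≡ false
open SimpleGraph public

record IsCycle {n : ℕ} (G : SimpleGraph n) (m : ℕ) (c : Fin (suc m) → Fin n) : Set where
  field
    long   : 3 ≤ suc m
    inj    : Injective _≡_ _≡_ c
    step   : ∀ (i : Fin m) → adj G (c (inject₁ i)) (c (fsuc i)) ≡ true
    close  : adj G (c (fromℕ m)) (c fzero) ≡ true

OddGirthAtLeast : {n : ℕ} → SimpleGraph n → ℕ → Set
OddGirthAtLeast {n} G L =
  ∀ (m : ℕ) (c : Fin (suc m) → Fin n) → IsCycle G m c → suc m % 2 ≡ 1 → L ≤ suc m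

ProperColouring : {n : ℕ} → SimpleGraph n → (q : ℕ) → (Fin n → Fin q) → Set
ProperColouring {n} G q col = ∀ (u v : Fin n) → adj G u v ≡ true → col u ≢ col v

Colourable : {n : ℕ} → SimpleGraph n → ℕ → Set
Colourable {n} G q = Σ (Fin n → Fin q) (ProperColouring G q)

IsChromaticNumber : {n : ℕ} → SimpleGraph n → ℕ → Set
IsChromaticNumber G χ = Colourable G χ × (∀ q → Colourable G q → χ ≤ q)

-- 2 C(k-1+⌊(χ-1)/2⌋, k-1) + C(k-1+⌊(χ-1)/2⌋, k) - 1   (for k ≥ 1, χ ≥ 1)
bound : ℕ → ℕ → ℕ
bound k χ = 2 * ((k ∸ 1 + (χ ∸ 1) / 2) C (k ∸ 1)) + ((k ∸ 1 + (χ ∸ 1) / 2) C k) ∸ 1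

{-# OPTIONS --safe #-}
-- Let f = ⌊(χ-1)/2⌋ ≥ 1.  There is a vertex v all of whose balls of radius i ≤ k
-- have at least a(i,f) = 2 C(i-1+f,i-1) + C(i-1+f,i) vertices; note
-- a(i,f) = a(i-1,f) + a(i,f-1).  Indeed, let Z be a smallest set of vertices whose
-- removal leaves a bipartite graph.  Then χ(Z) ≥ χ - 2, so by induction on f some
-- v ∈ Z has balls of size a(i,f-1) already inside Z.  Balls of radius less than k
-- are bipartite by the odd girth, so replacing the part of Z in the ball of radius i
-- around v by the sphere of radius i gives another such set; by minimality the
-- sphere has at least a(i,f-1) vertices, and summing over spheres yields the claim.
-- For f = 1 one needs that every sphere has two vertices: across a one-vertex sphere
-- a 2-colouring of the ball can be glued to the one outside, so that Z was not minimal.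
module Submission where

open import Defs
open import Data.Nat using (ℕ; _≤_; _+_; _*_)
open import Data.Bool using (Bool; true; false; not; _∧_; _∨_; _xor_; if_then_else_)
open import Data.Bool.Properties using (not-involutive; ¬-not; xor-assoc; xor-same; xor-identityʳ) renaming (_≟_ to _≟ᵇ_)
open import Data.Empty using (⊥-elim)
open import Data.Fin using (Fin; inject₁; fromℕ) renaming (zero to fzero; suc to fsuc)
open import Data.Fin.Properties using (_≟_; any?; suc-injective)
open import Data.Nat using (zero; suc; _∸_; _<_; _%_; _/_; z≤n; s≤s; _≤?_)
open import Data.Nat.Combinatorics using (_C_; nCn≡1; nC1≡n; nCk+nC[k+1]≡[n+1]C[k+1]; k>n⇒nCk≡0)
open import Data.Nat.DivMod using ([m+n]%n≡m%n; m/n*n≤m)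
open import Data.Nat.Properties hiding (_≟_; suc-injective)
open import Data.Nat.Tactic.RingSolver using (solve-∀)
open import Data.Product using (Σ; ∃; _×_; _,_; proj₁; proj₂)
open import Data.Sum using (_⊎_; inj₁; inj₂)
open import Data.Unit using (⊤; tt)
open import Function using (_∘_)
open import Function.Definitions using (Injective)
open import Relation.Binary.PropositionalEquality using (_≡_; _≢_; refl; trans; cong; cong₂; subst; module ≡-Reasoning) renaming (sym to ≡-sym)
open import Relation.Nullary using (¬_; Dec; does; yes; no)
open import Relation.Nullary.Decidable using (dec-true)

-- Parity

-- A Boolean parity turns sums of lengths into `xor` and can be compared with vertex sides;
-- `odd⇒%2≡1` translates it for the odd girth hypothesis.
odd : ℕ → Bool
odd zero    = false
odd (suc n) = not (odd n)

odd-+ : ∀ m n → odd (m + n) ≡ odd m xor odd n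
odd-+ zero    n = refl
odd-+ (suc m) n with odd m | odd-+ m n
... | true  | p = trans (cong not p) (not-involutive (odd n))
... | false | p = cong not p

odd⇒%2≡1 : ∀ n → odd n ≡ true → n % 2 ≡ 1
odd⇒%2≡1 (suc zero)    _ = refl
odd⇒%2≡1 (suc (suc n)) p =
  trans (cong (_% 2) (+-comm 2 n))
    (trans ([m+n]%n≡m%n n 2) (odd⇒%2≡1 n (trans (≡-sym (not-involutive (odd n))) p)))

-- Finite sets as Boolean predicates

VSet : ℕ → Set
VSet n = Fin n → Bool

infix 4 _∈_ _∉_ _⊆_
infixr 6 _∩_ _∪_ _∖_

_∈_ _∉_ : ∀ {n} → Fin n → VSet n → Set
u ∈ P = P u ≡ true
u ∉ P = P u ≡ false

_⊆_ : ∀ {n} → VSet n → VSet n → Set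
P ⊆ Q = ∀ u → u ∈ P → u ∈ Q

_∩_ _∪_ _∖_ : ∀ {n} → VSet n → VSet n → VSet n
(P ∩ Q) u = P u ∧ Q u
(P ∪ Q) u = P u ∨ Q u
(P ∖ Q) u = P u ∧ not (Q u)

∧-intro : ∀ {a b} → a ≡ true → b ≡ true → a ∧ b ≡ true
∧-intro refl refl = refl

∧-elimˡ : ∀ {a b} → a ∧ b ≡ true → a ≡ true
∧-elimˡ {true} _ = refl

∧-elimʳ : ∀ {a b} → a ∧ b ≡ true → b ≡ true
∧-elimʳ {true} p = p

∨-introˡ : ∀ {a b} → a ≡ true → a ∨ b ≡ true
∨-introˡ refl = refl

∨-introʳ : ∀ {a b} → b ≡ true → a ∨ b ≡ true
∨-introʳ {true}  _ = refl
∨-introʳ {false} p = p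

∨-elim : ∀ {a b} → a ∨ b ≡ true → (a ≡ true) ⊎ (b ≡ true)
∨-elim {true}  _ = inj₁ refl
∨-elim {false} p = inj₂ p

true≢false : ∀ {a} {A : Set} → a ≡ true → a ≡ false → A
true≢false refl ()

-- Cardinalities

card : ∀ {n} → VSet n → ℕ
card {zero}  P = 0
card {suc n} P = (if P fzero then 1 else 0) + card (P ∘ fsuc)

card≤n : ∀ {n} (P : VSet n) → card P ≤ n
card≤n {zero}  P = z≤n
card≤n {suc n} P with P fzero
... | true  = s≤s (card≤n (P ∘ fsuc))
... | false = m≤n⇒m≤1+n (card≤n (P ∘ fsuc))

card-mono : ∀ {n} {P Q : VSet n} → P ⊆ Q → card P ≤ card Q
card-mono {zero}          P⊆Q = z≤n
card-mono {suc n} {P} {Q} P⊆Q with P fzero | Q fzero | P⊆Q fzero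
... | true  | true  | _ = s≤s (card-mono (P⊆Q ∘ fsuc))
... | true  | false | h with () ← h refl
... | false | true  | _ = m≤n⇒m≤1+n (card-mono (P⊆Q ∘ fsuc))
... | false | false | _ = card-mono (P⊆Q ∘ fsuc)

card-split : ∀ {n} (P Q : VSet n) → card P ≡ card (P ∩ Q) + card (P ∖ Q)
card-split {zero}  P Q = refl
card-split {suc n} P Q with P fzero | Q fzero
... | true  | true  = cong suc (card-split (P ∘ fsuc) (Q ∘ fsuc))
... | true  | false = trans (cong suc (card-split (P ∘ fsuc) (Q ∘ fsuc))) (≡-sym (+-suc _ _))
... | false | _     = card-split (P ∘ fsuc) (Q ∘ fsuc)

card-∪ : ∀ {n} (P Q : VSet n) → card (P ∪ Q) ≤ card P + card Q
card-∪ {zero}  P Q = z≤n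
card-∪ {suc n} P Q with P fzero | Q fzero | card-∪ (P ∘ fsuc) (Q ∘ fsuc)
... | true  | true  | h = s≤s (≤-trans h (+-monoʳ-≤ (card (P ∘ fsuc)) (n≤1+n _)))
... | true  | false | h = s≤s h
... | false | true  | h = ≤-trans (s≤s h) (≤-reflexive (≡-sym (+-suc _ _)))
... | false | false | h = h

card-≥1 : ∀ {n} {P : VSet n} {u} → u ∈ P → 1 ≤ card P
card-≥1 {suc n} {P} {fzero}  u∈P rewrite u∈P = s≤s z≤n
card-≥1 {suc n} {P} {fsuc u} u∈P = ≤-trans (card-≥1 {P = P ∘ fsuc} u∈P) (m≤n+m _ _)

card-≥2 : ∀ {n} {P : VSet n} {u w} → u ∈ P → w ∈ P → u ≢ w → 2 ≤ card P
card-≥2 {u = fzero}  {fzero}  u∈P w∈P u≢w = ⊥-elim (u≢w refl)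
card-≥2 {P = P} {fzero}  {fsuc w} u∈P w∈P u≢w rewrite u∈P = s≤s (card-≥1 {P = P ∘ fsuc} w∈P)
card-≥2 {P = P} {fsuc u} {fzero}  u∈P w∈P u≢w rewrite w∈P = s≤s (card-≥1 {P = P ∘ fsuc} u∈P)
card-≥2 {P = P} {fsuc u} {fsuc w} u∈P w∈P u≢w =
  ≤-trans (card-≥2 {P = P ∘ fsuc} u∈P w∈P (u≢w ∘ cong fsuc)) (m≤n+m _ _)

card<2⇒subsingleton : ∀ {n} {P : VSet n} → card P < 2 → ∀ u w → u ∈ P → w ∈ P → u ≡ w
card<2⇒subsingleton {P = P} P<2 u w u∈P w∈P with u ≟ w
... | yes u≡w = u≡w
... | no  u≢w = ⊥-elim (<⇒≱ P<2 (card-≥2 {P = P} u∈P w∈P u≢w))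

-- The recursive bounds and their binomial form

-- ballBound i g is a(i, g + 1).
mutual
  ballBound : ℕ → ℕ → ℕ
  ballBound zero    g = 1
  ballBound (suc i) g = ballBound i g + sphereBound i g

  -- The increment from radius `i` to `i + 1`. The starting value 2 is what the formula gives for
  -- `a(i + 1, 0)`.
  sphereBound : ℕ → ℕ → ℕ
  sphereBound i zero    = 2
  sphereBound i (suc g) = ballBound (suc i) g

-- Pascal's rule on both binomials splits the left side into the instances `(i - 1, g)` and
-- `(i, g - 1)`, which share one upper index. This is the recursion of `ballBound`.
ballBound-binomial : ∀ i g →
  2 * ((i + suc g) C i) + ((i + suc g) C suc i) ≡ ballBound (suc i) g
ballBound-binomial zero zero = refl
ballBound-binomial zero (suc g) = cong suc (trans
  (cong suc (trans (nC1≡n (2 + g)) (cong suc (≡-sym (nC1≡n (suc g))))))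
  (ballBound-binomial zero g))
ballBound-binomial (suc i) zero = begin
  2 * (suc m C suc i) + (suc m C suc (suc i))
    ≡⟨ cong₂ (λ x y → 2 * x + y) (pascal m i) (pascal m (suc i)) ⟨
  2 * ((m C i) + (m C suc i)) + ((m C suc i) + (m C suc (suc i)))
    ≡⟨ cong₂ (λ x y → 2 * ((m C i) + x) + (x + y)) top (k>n⇒nCk≡0 (≤-reflexive (cong suc (+-comm i 1)))) ⟩
  2 * ((m C i) + 1) + (1 + 0)
    ≡⟨ rearrange (m C i) ⟩
  (2 * (m C i) + 1) + 2
    ≡⟨ cong (λ x → (2 * (m C i) + x) + 2) top ⟨
  (2 * (m C i) + (m C suc i)) + 2
    ≡⟨ cong (_+ 2) (ballBound-binomial i zero) ⟩
  ballBound (suc i) zero + 2 ∎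
  where
  open ≡-Reasoning
  m = i + 1
  pascal = nCk+nC[k+1]≡[n+1]C[k+1]
  top : m C suc i ≡ 1
  top = trans (cong (_C suc i) (+-comm i 1)) (nCn≡1 (suc i))
  rearrange : ∀ x → 2 * (x + 1) + (1 + 0) ≡ (2 * x + 1) + 2
  rearrange = solve-∀
ballBound-binomial (suc i) (suc g) = begin
  2 * (suc m C suc i) + (suc m C suc (suc i))
    ≡⟨ cong₂ (λ x y → 2 * x + y) (pascal m i) (pascal m (suc i)) ⟨
  2 * ((m C i) + (m C suc i)) + ((m C suc i) + (m C suc (suc i)))
    ≡⟨ rearrange (m C i) (m C suc i) (m C suc (suc i)) ⟩
  (2 * (m C i) + (m C suc i)) + (2 * (m C suc i) + (m C suc (suc i)))
    ≡⟨ cong₂ _+_ (ballBound-binomial i (suc g))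
         (trans (cong (λ x → 2 * (x C suc i) + (x C suc (suc i))) (+-suc i (suc g)))
           (ballBound-binomial (suc i) g)) ⟩
  ballBound (suc i) (suc g) + ballBound (suc (suc i)) g ∎
  where
  open ≡-Reasoning
  m = i + suc (suc g)
  pascal = nCk+nC[k+1]≡[n+1]C[k+1]
  rearrange : ∀ x y z → 2 * (x + y) + (y + z) ≡ (2 * x + y) + (2 * y + z)
  rearrange = solve-∀

module _ {n : ℕ} (G : SimpleGraph n) where

  -- Walks and odd cycles

  data Walk : Fin n → Fin n → ℕ → Set where
    nil  : ∀ {u} → Walk u u 0
    cons : ∀ {u w v d} → adj G u w ≡ true → Walk w v d → Walk u v (suc d)

  at : ∀ {u v d} → Walk u v d → Fin (suc d) → Fin n
  at {u} w          fzero    = u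
  at     (cons _ w) (fsuc i) = at w i

  Avoids : ∀ {u v d} → Fin n → Walk u v d → Set
  Avoids {u} y nil        = u ≢ y
  Avoids {u} y (cons _ w) = u ≢ y × Avoids y w

  Simple : ∀ {u v d} → Walk u v d → Set
  Simple     nil        = ⊤
  Simple {u} (cons _ w) = Avoids u w × Simple w

  avoids-at : ∀ {u v d y} (w : Walk u v d) → Avoids y w → ∀ i → at w i ≢ y
  avoids-at nil        a       fzero    = a
  avoids-at (cons _ w) (a , _) fzero    = a
  avoids-at (cons _ w) (_ , a) (fsuc i) = avoids-at w a i

  at-last : ∀ {u v d} (w : Walk u v d) → at w (fromℕ d) ≡ v
  at-last nil        = refl
  at-last (cons _ w) = at-last w

  at-step : ∀ {u v d} (w : Walk u v d) (i : Fin d) → adj G (at w (inject₁ i)) (at w (fsuc i)) ≡ true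
  at-step (cons e nil)        fzero    = e
  at-step (cons e (cons _ _)) fzero    = e
  at-step (cons e w)          (fsuc i) = at-step w i

  at-injective : ∀ {u v d} (w : Walk u v d) → Simple w → Injective _≡_ _≡_ (at w)
  at-injective w          s       {fzero}  {fzero}  p = refl
  at-injective (cons _ w) (a , s) {fzero}  {fsuc j} p = ⊥-elim (avoids-at w a j (≡-sym p))
  at-injective (cons _ w) (a , s) {fsuc i} {fzero}  p = ⊥-elim (avoids-at w a i p)
  at-injective (cons _ w) (a , s) {fsuc i} {fsuc j} p = cong fsuc (at-injective w s p)

  avoids-end : ∀ {u v d} (w : Walk u v d) → ¬ Avoids v w
  avoids-end {d = d} w a = avoids-at w a (fromℕ d) (at-last w)

  -- The field `before-avoids` carries simplicity through the recursion: a vertex prepended to `w`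
  -- is also new to the initial piece.
  record Split {u v d} (w : Walk u v d) (x : Fin n) : Set where
    constructor mkSplit
    field
      {d₁ d₂}       : ℕ
      lengths       : d₁ + d₂ ≡ d
      before        : Walk u x d₁
      before-simple : Simple before
      before-avoids : ∀ y → Avoids y w → Avoids y before
      after         : Walk x v d₂
      after-simple  : Simple after

  avoids-start : ∀ {u v d y} (w : Walk u v d) → Avoids y w → u ≢ y
  avoids-start w a = avoids-at w a fzero

  split : ∀ {u v d} (w : Walk u v d) → Simple w → ∀ x → Avoids x w ⊎ Split w x
  split {u} w s x with u ≟ x
  split w s x | yes refl = inj₂ (mkSplit refl nil tt (λ _ → avoids-start w) w s)
  split nil s x | no u≢x = inj₁ u≢x
  split (cons e w) (a , s) x | no u≢x with split w s x
  ... | inj₁ x∉w = inj₁ (u≢x , x∉w)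
  ... | inj₂ (mkSplit len p p-simple p-avoids q q-simple) =
        inj₂ (mkSplit (cong suc len) (cons e p) (p-avoids _ a , p-simple)
               (λ y → λ { (u≢y , y∉w) → u≢y , p-avoids y y∉w }) q q-simple)

  adj-irrefl : ∀ {u w} → adj G u w ≡ true → u ≢ w
  adj-irrefl {u} e refl = true≢false e (irrefl G u)

  -- At least three vertices are guaranteed: `d = 0` would make `e` a loop, and `d = 1` contradicts
  -- the parity assumption.
  cycle-of : ∀ {u w d} → adj G u w ≡ true → (p : Walk w u d) → Simple p →
             odd (suc d) ≡ true → IsCycle G d (at p)
  cycle-of e nil _ _ = ⊥-elim (adj-irrefl e refl)
  cycle-of {d = suc (suc d)} e p s _ = record
    { long  = s≤s (s≤s (s≤s z≤n))
    ; inj   = at-injective p s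
    ; step  = at-step p
    ; close = trans (cong (λ x → adj G x (at p fzero)) (at-last p)) e
    }

  module _ {L : ℕ} (og : OddGirthAtLeast G L) where

    -- A closed detour of even length can be cut out without changing the parity.
    simplify : ∀ {u v d} → Walk u v d →
               (L ≤ d) ⊎ Σ ℕ λ d′ → d′ ≤ d × odd d′ ≡ odd d × Σ (Walk u v d′) Simple
    simplify nil = inj₂ (0 , z≤n , refl , nil , tt)
    simplify {u} (cons {d = d} e w) with simplify w
    ... | inj₁ L≤d = inj₁ (m≤n⇒m≤1+n L≤d)
    ... | inj₂ (d′ , d′≤d , par , p , s) with split p s u
    ...   | inj₁ u∉p = inj₂ (suc d′ , s≤s d′≤d , cong not par , cons e p , u∉p , s)
    ...   | inj₂ (mkSplit {d₁} {d₂} len p₁ s₁ _ p₂ s₂) with odd d₁ in eq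
    ...     | false = inj₁ (≤-trans
                        (og d₁ (at p₁) (cycle-of e p₁ s₁ (cong not eq)) (odd⇒%2≡1 (suc d₁) (cong not eq)))
                        (s≤s (≤-trans (m+n≤o⇒m≤o d₁ (≤-reflexive len)) d′≤d)))
    ...     | true  = inj₂ (d₂ , m≤n⇒m≤1+n (≤-trans (m+n≤o⇒n≤o d₁ (≤-reflexive len)) d′≤d)
                           , parity , p₂ , s₂)
      where
      parity : odd d₂ ≡ not (odd d)
      parity = trans (≡-sym (not-involutive (odd d₂)))
                 (cong not (trans (≡-sym (trans (cong odd (≡-sym len))
                   (trans (odd-+ d₁ d₂) (cong (_xor odd d₂) eq)))) par))

    -- Passes from odd cycles to odd closed walks. If `simplify` returns a simple walk from `v` to
    -- `v`, it must be `nil`, whose length is even.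
    odd-closed-walk-long : ∀ {v d} → Walk v v d → odd d ≡ true → L ≤ d
    odd-closed-walk-long w od with simplify w
    ... | inj₁ L≤d = L≤d
    ... | inj₂ (_ , _ , par , nil , _) = true≢false od (≡-sym par)
    ... | inj₂ (_ , _ , par , cons _ p , v∉p , _) = ⊥-elim (avoids-end p v∉p)

  adj-sym : ∀ {u w} → adj G u w ≡ true → adj G w u ≡ true
  adj-sym {u} {w} e = trans (sym G w u) e

  reverse-++ : ∀ {a b c m p} → Walk a b m → Walk a c p → Walk b c (m + p)
  reverse-++ nil q = q
  reverse-++ {p = p} (cons {d = m} e w) q = subst (Walk _ _) (+-suc m p) (reverse-++ w (cons (adj-sym e) q))

  -- Balls in the subgraph induced by W

  ball : VSet n → Fin n → ℕ → VSet n
  ball W v zero    u = does (u ≟ v)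
  ball W v (suc i) u = ball W v i u ∨ (W u ∧ does (any? (λ x → (ball W v i x ∧ adj G x u) ≟ᵇ true)))

  -- The index is off by one: this is the sphere of radius `i + 1`.
  sphere : VSet n → Fin n → ℕ → VSet n
  sphere W v i = ball W v (suc i) ∖ ball W v i

  ball-center : ∀ W v i → v ∈ ball W v i
  ball-center W v zero    = dec-true (v ≟ v) refl
  ball-center W v (suc i) = ∨-introˡ (ball-center W v i)

  ball-step : ∀ W v i {x u} → x ∈ ball W v i → adj G x u ≡ true → u ∈ W → u ∈ ball W v (suc i)
  ball-step W v i {x} {u} x∈B e u∈W =
    ∨-introʳ {ball W v i u} (∧-intro u∈W (dec-true (any? _) (x , ∧-intro x∈B e)))

  ball-suc⁻ : ∀ W v i {u} → u ∈ ball W v (suc i) →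
              (u ∈ ball W v i) ⊎ (u ∈ W × ∃ λ x → x ∈ ball W v i × adj G x u ≡ true)
  ball-suc⁻ W v i {u} u∈B with ∨-elim {ball W v i u} u∈B
  ... | inj₁ h = inj₁ h
  ... | inj₂ h with any? (λ x → (ball W v i x ∧ adj G x u) ≟ᵇ true)
  ...   | yes (x , p) = inj₂ (∧-elimˡ h , x , ∧-elimˡ p , ∧-elimʳ {ball W v i x} p)
  ...   | no  _       = true≢false (∧-elimʳ {W u} h) refl

  ball-mono : ∀ {Z W} → Z ⊆ W → ∀ v i → ball Z v i ⊆ ball W v i
  ball-mono Z⊆W v zero    u h = h
  ball-mono {Z} {W} Z⊆W v (suc i) u h with ball-suc⁻ Z v i h
  ... | inj₁ p                 = ∨-introˡ (ball-mono Z⊆W v i u p)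
  ... | inj₂ (u∈Z , x , p , e) = ball-step W v i (ball-mono Z⊆W v i x p) e (Z⊆W u u∈Z)

  ball⊆ : ∀ {W v} → v ∈ W → ∀ i → ball W v i ⊆ W
  ball⊆ {W} {v} v∈W zero u h with u ≟ v
  ... | yes refl = v∈W
  ... | no  _    = true≢false h refl
  ball⊆ {W} {v} v∈W (suc i) u h with ball-suc⁻ W v i h
  ... | inj₁ p         = ball⊆ v∈W i u p
  ... | inj₂ (u∈W , _) = u∈W

  card-ball-suc : ∀ W v i → card (ball W v i) + card (sphere W v i) ≤ card (ball W v (suc i))
  card-ball-suc W v i = ≤-trans
    (+-monoˡ-≤ (card (sphere W v i)) (card-mono {P = ball W v i} {ball W v (suc i) ∩ ball W v i} λ u h → ∧-intro (∨-introˡ h) h))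
    (≤-reflexive (≡-sym (card-split (ball W v (suc i)) (ball W v i))))

  -- The parity of the length of some walk to v, for vertices of the ball of radius i
  -- (junk outside).
  parity : VSet n → Fin n → ℕ → Fin n → Bool
  parity W v zero    u = false
  parity W v (suc i) u = if ball W v i u then parity W v i u else flip (any? (λ x → (ball W v i x ∧ adj G x u) ≟ᵇ true))
    where
    flip : Dec (∃ λ x → (ball W v i x ∧ adj G x u) ≡ true) → Bool
    flip (yes (x , _)) = not (parity W v i x)
    flip (no _)        = false

  parity-walk : ∀ W v i {u} → u ∈ ball W v i →
                Σ ℕ λ d → d ≤ i × odd d ≡ parity W v i u × Walk u v d
  parity-walk W v zero {u} h with u ≟ v
  ... | yes refl = 0 , z≤n , refl , nil
  ... | no  _    = true≢false h refl
  parity-walk W v (suc i) {u} h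
    -- These are the decisions that `parity` inspects, so `x` is the very neighbour whose parity was
    -- flipped.
    with ball W v i u in eq | any? (λ x → (ball W v i x ∧ adj G x u) ≟ᵇ true)
  ... | true | _ = let d , d≤i , par , w = parity-walk W v i eq in d , m≤n⇒m≤1+n d≤i , par , w
  ... | false | no _ = true≢false (∧-elimʳ {W u} h) refl
  ... | false | yes (x , p) =
    let d , d≤i , par , w = parity-walk W v i (∧-elimˡ p)
    in suc d , s≤s d≤i , cong not par , cons (adj-sym (∧-elimʳ {ball W v i x} p)) w

  parity-suc : ∀ W v i {u} → u ∈ ball W v i → parity W v (suc i) u ≡ parity W v i u
  parity-suc W v i u∈B rewrite u∈B = refl

  ColourableOn : VSet n → ℕ → Set
  ColourableOn W q = Σ (Fin n → Fin q) λ col →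
    ∀ {u u′} → u ∈ W → u′ ∈ W → adj G u u′ ≡ true → col u ≢ col u′

  module _ {k : ℕ} (og : OddGirthAtLeast G (2 * k + 1)) where

    -- Equal parities would close two walks to `v` and the edge into an odd closed walk of length at
    -- most `i + (i + 1) + 1`, hence at most `2 * k`. One end must lie in the smaller ball: two ends
    -- on the sphere would only give `2 * k + 1`.
    parity-proper : ∀ W v {i u u′} → i < k → u ∈ ball W v i → u′ ∈ ball W v (suc i) →
                    adj G u u′ ≡ true → parity W v (suc i) u ≢ parity W v (suc i) u′
    parity-proper W v {i} {u} {u′} i<k u∈B u′∈B e same
      with parity-walk W v i u∈B | parity-walk W v (suc i) u′∈B
    ... | d , d≤i , par , w | d′ , d′≤1+i , par′ , w′ = <⇒≱ short long
      where
      d≡d′ : odd d ≡ odd d′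
      d≡d′ = trans par (trans (≡-sym (parity-suc W v i u∈B)) (trans same (≡-sym par′)))

      x-xor-not-x : ∀ x → x xor not x ≡ true
      x-xor-not-x true  = refl
      x-xor-not-x false = refl

      long : 2 * k + 1 ≤ d + suc d′
      long = odd-closed-walk-long og (reverse-++ w (cons e w′))
        (trans (odd-+ d (suc d′)) (trans (cong (λ x → x xor not (odd d′)) d≡d′) (x-xor-not-x (odd d′))))

      short : d + suc d′ < 2 * k + 1
      short = begin-strict
        d + suc d′    ≤⟨ +-mono-≤ d≤i (s≤s d′≤1+i) ⟩
        i + suc (suc i) ≡⟨ +-suc i (suc i) ⟩
        suc i + suc i ≤⟨ +-mono-≤ i<k i<k ⟩
        k + k         ≡⟨ cong (k +_) (≡-sym (+-identityʳ k)) ⟩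
        2 * k         <⟨ m<m+n (2 * k) (s≤s z≤n) ⟩
        2 * k + 1     ∎
        where open ≤-Reasoning

    -- Odd cycle transversals

    record Transversal (W Z : VSet n) : Set where
      constructor mkTransversal
      field
        within : Z ⊆ W
        side   : Fin n → Bool
        proper : ∀ {u u′} → u ∈ W → u ∉ Z → u′ ∈ W → u′ ∉ Z → adj G u u′ ≡ true → side u ≢ side u′

    open Transversal

    -- The sides inside the ball are given by parity and those outside by the old
    -- transversal; the shift makes them agree on the sphere.
    module _ {W Z Z′ : VSet n} (T : Transversal W Z) (v : Fin n) {i : ℕ} (i<k : i < k)
             (Z′⊆W : Z′ ⊆ W) (Z∖B⊆Z′ : Z ∖ ball W v (suc i) ⊆ Z′)
             (unique : ∀ {u u′} → u ∈ sphere W v i → u ∉ Z′ → u′ ∈ sphere W v i → u′ ∉ Z′ → u ≡ u′)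
             (outside : ∀ {u} → u ∈ sphere W v i → u ∉ Z′ → u ∉ Z)
             (shift : Bool)
             (agree : ∀ {u} → u ∈ sphere W v i → u ∉ Z′ → shift xor parity W v (suc i) u ≡ side T u)
      where

      private
        B B⁺ : VSet n
        B  = ball W v i
        B⁺ = ball W v (suc i)

      glued : Fin n → Bool
      glued u = if B⁺ u then shift xor parity W v (suc i) u else side T u

      glued-in : ∀ {u} → u ∈ B⁺ → glued u ≡ shift xor parity W v (suc i) u
      glued-in h rewrite h = refl

      glued-out : ∀ {u} → u ∉ B⁺ → glued u ≡ side T u
      glued-out h rewrite h = refl

      xor-cancelˡ : ∀ s {x y} → s xor x ≡ s xor y → x ≡ y
      xor-cancelˡ true  {true}  {true}  _ = refl
      xor-cancelˡ true  {false} {false} _ = refl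
      xor-cancelˡ false p = p

      parity-case : ∀ {u u′} → u ∈ B → u′ ∈ B⁺ → adj G u u′ ≡ true → glued u ≢ glued u′
      parity-case u∈B u′∈B⁺ e p = parity-proper W v i<k u∈B u′∈B⁺ e
        (xor-cancelˡ shift (trans (≡-sym (glued-in (∨-introˡ u∈B))) (trans p (glued-in u′∈B⁺))))

      ∉Z : ∀ {u} → u ∉ Z′ → u ∉ B⁺ → u ∉ Z
      ∉Z {u} u∉Z′ u∉B⁺ = ¬-not λ u∈Z → true≢false (Z∖B⊆Z′ u (∧-intro u∈Z (cong not u∉B⁺))) u∉Z′

      -- An edge leaving `B⁺` cannot start in `B`, so `u` is on the sphere. There `agree` turns its
      -- colour into the old side, and `T` separates the two ends.
      crossing-case : ∀ {u u′} → u ∈ W → u ∉ Z′ → u′ ∈ W → u′ ∉ Z′ → u ∈ B⁺ → u′ ∉ B⁺ →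
                      adj G u u′ ≡ true → glued u ≢ glued u′
      crossing-case {u} u∈W u∉Z′ u′∈W u′∉Z′ u∈B⁺ u′∉B⁺ e p with B u ≟ᵇ true
      ... | yes u∈B = true≢false (ball-step W v i u∈B e u′∈W) u′∉B⁺
      ... | no  u∉B = proper T u∈W (outside u∈S u∉Z′) u′∈W (∉Z u′∉Z′ u′∉B⁺) e
                      (trans (≡-sym (agree u∈S u∉Z′)) (trans (≡-sym (glued-in u∈B⁺)) (trans p (glued-out u′∉B⁺))))
        where
        u∈S : u ∈ sphere W v i
        u∈S = ∧-intro u∈B⁺ (cong not (¬-not u∉B))

      glue : Transversal W Z′
      glue = mkTransversal Z′⊆W glued λ {u} {u′} u∈W u∉Z′ u′∈W u′∉Z′ e →
        cases u∈W u∉Z′ u′∈W u′∉Z′ e (B⁺ u ≟ᵇ true) (B⁺ u′ ≟ᵇ true) (B u ≟ᵇ true) (B u′ ≟ᵇ true)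
        where
        cases : ∀ {u u′} → u ∈ W → u ∉ Z′ → u′ ∈ W → u′ ∉ Z′ → adj G u u′ ≡ true →
                Dec (u ∈ B⁺) → Dec (u′ ∈ B⁺) → Dec (u ∈ B) → Dec (u′ ∈ B) → glued u ≢ glued u′
        cases u∈W u∉Z′ u′∈W u′∉Z′ e (yes p) (yes q) (yes r) _ = parity-case r q e
        cases u∈W u∉Z′ u′∈W u′∉Z′ e (yes p) (yes q) _ (yes s) = parity-case s p (adj-sym e) ∘ ≡-sym
        -- Parity says nothing about edges within the sphere; `unique` excludes them, since both
        -- ends would coincide.
        cases u∈W u∉Z′ u′∈W u′∉Z′ e (yes p) (yes q) (no r) (no s) =
          ⊥-elim (adj-irrefl e (unique (∧-intro p (cong not (¬-not r))) u∉Z′ (∧-intro q (cong not (¬-not s))) u′∉Z′))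
        cases u∈W u∉Z′ u′∈W u′∉Z′ e (yes p) (no q) _ _ = crossing-case u∈W u∉Z′ u′∈W u′∉Z′ p (¬-not q) e
        cases u∈W u∉Z′ u′∈W u′∉Z′ e (no p) (yes q) _ _ =
          crossing-case u′∈W u′∉Z′ u∈W u∉Z′ q (¬-not p) (adj-sym e) ∘ ≡-sym
        cases u∈W u∉Z′ u′∈W u′∉Z′ e (no p) (no q) _ _ r =
          proper T u∈W (∉Z u∉Z′ (¬-not p)) u′∈W (∉Z u′∉Z′ (¬-not q)) e
            (trans (≡-sym (glued-out (¬-not p))) (trans r (glued-out (¬-not q))))

    -- Stands in for minimality: what holds around a smallest transversal is proved for any
    -- transversal with `Smaller` as the alternative.
    Smaller : VSet n → VSet n → Set
    Smaller W Z = Σ (VSet n) λ Z′ → card Z′ < card Z × Transversal W Z′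

    module _ {W Z : VSet n} (T : Transversal W Z) {v : Fin n} (v∈Z : v ∈ Z) {i : ℕ} (i<k : i < k) where

      private
        B⁺ S : VSet n
        B⁺ = ball W v (suc i)
        S  = sphere W v i

        v∈W : v ∈ W
        v∈W = within T v v∈Z

        S⊆W : S ⊆ W
        S⊆W u h = ball⊆ v∈W (suc i) u (∧-elimˡ h)

      replace-by-sphere : card S < card (Z ∩ B⁺) → Smaller W Z
      replace-by-sphere S<Z∩B =
        -- All of `S` lies in `Z′`, so the gluing conditions on the sphere are vacuous and the shift
        -- `false` is arbitrary.
        Z′ , smaller , glue T v i<k Z′⊆W (λ u → ∨-introˡ) (λ h h′ → absurd h h′) absurd false (λ h h′ → absurd h h′)
        where
        Z′ : VSet n
        Z′ = (Z ∖ B⁺) ∪ S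

        Z′⊆W : Z′ ⊆ W
        Z′⊆W u h with ∨-elim {(Z ∖ B⁺) u} h
        ... | inj₁ p = within T u (∧-elimˡ p)
        ... | inj₂ p = S⊆W u p

        absurd : ∀ {A : Set} {u} → u ∈ S → u ∉ Z′ → A
        absurd {u = u} u∈S = true≢false (∨-introʳ {(Z ∖ B⁺) u} u∈S)

        smaller : card Z′ < card Z
        smaller = begin-strict
          card Z′                       ≤⟨ card-∪ (Z ∖ B⁺) S ⟩
          card (Z ∖ B⁺) + card S        <⟨ +-monoʳ-< (card (Z ∖ B⁺)) S<Z∩B ⟩
          card (Z ∖ B⁺) + card (Z ∩ B⁺) ≡⟨ +-comm (card (Z ∖ B⁺)) _ ⟩
          card (Z ∩ B⁺) + card (Z ∖ B⁺) ≡⟨ card-split Z B⁺ ⟨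
          card Z                        ∎
          where open ≤-Reasoning

      remove-ball : card S < 2 → (∀ u → u ∈ S → u ∉ Z) → Smaller W Z
      remove-ball S<2 S∩Z=∅ = Z ∖ B⁺ , smaller , transversal
        where
        smaller : card (Z ∖ B⁺) < card Z
        smaller = ≤-trans
          (+-monoˡ-≤ (card (Z ∖ B⁺)) (card-≥1 {P = Z ∩ B⁺} (∧-intro v∈Z (ball-center W v (suc i)))))
          (≤-reflexive (≡-sym (card-split Z B⁺)))

        shift : Σ Bool λ s → ∀ {u} → u ∈ S → s xor parity W v (suc i) u ≡ side T u
        shift with any? (λ w → S w ≟ᵇ true)
        ... | no  S=∅        = false , λ {u} u∈S → ⊥-elim (S=∅ (u , u∈S))
        -- The sphere is just `w`, and this shift cancels the parity of `w` to leave `side T w`.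
        ... | yes (w , w∈S) = side T w xor parity W v (suc i) w , λ {u} u∈S →
                subst (λ x → (side T w xor parity W v (suc i) w) xor parity W v (suc i) x ≡ side T x)
                  (card<2⇒subsingleton S<2 w u w∈S u∈S)
                  (trans (xor-assoc (side T w) _ _)
                    (trans (cong (side T w xor_) (xor-same (parity W v (suc i) w))) (xor-identityʳ (side T w))))

        transversal : Transversal W (Z ∖ B⁺)
        transversal = glue T v i<k (λ u h → within T u (∧-elimˡ h)) (λ u h → h)
          (λ {u} {u′} p _ q _ → card<2⇒subsingleton S<2 u u′ p q)
          (λ {u} p _ → S∩Z=∅ u p) (proj₁ shift) (λ p _ → proj₂ shift p)

      sphere-large-or-smaller : (card (Z ∩ B⁺) ≤ card S × 2 ≤ card S) ⊎ Smaller W Z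
      sphere-large-or-smaller with card (Z ∩ B⁺) ≤? card S | 2 ≤? card S
      ... | no  Z∩B≰S | _       = inj₂ (replace-by-sphere (≰⇒> Z∩B≰S))
      ... | yes Z∩B≤S | yes 2≤S = inj₁ (Z∩B≤S , 2≤S)
      -- A vertex of `Z` on the sphere would join `v` as a second vertex of `Z ∩ B⁺` and force
      -- `2 ≤ card S`; hence the sphere misses `Z`.
      ... | yes Z∩B≤S | no  2≰S = inj₂ (remove-ball (≰⇒> 2≰S) λ u u∈S → ¬-not λ u∈Z → 2≰S (≤-trans
              (card-≥2 {P = Z ∩ B⁺} (∧-intro v∈Z (ball-center W v (suc i))) (∧-intro u∈Z (∧-elimˡ u∈S))
                λ { refl → true≢false (ball-center W v i) (not-true (∧-elimʳ {B⁺ v} u∈S)) })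
              Z∩B≤S))
        where
        not-true : ∀ {b} → not b ≡ true → b ≡ false
        not-true {false} _ = refl

    -- Balls of guaranteed size

    -- The two sides get fresh colours and `Z` keeps its own. Contrapositively, `Z` inherits
    -- non-colourability with two colours fewer.
    colour-transversal : ∀ {W Z q} → Transversal W Z → ColourableOn Z q → ColourableOn W (2 + q)
    colour-transversal {W} {Z} {q} T (col , col-proper) = colour , colour-proper
      where
      pick : Bool → Bool → Fin q → Fin (2 + q)
      pick true  _     c = fsuc (fsuc c)
      pick false true  _ = fzero
      pick false false _ = fsuc fzero

      colour : Fin n → Fin (2 + q)
      colour u = pick (Z u) (side T u) (col u)

      pick-≢ : ∀ {z z′ s s′ c c′} → (z ≡ true → z′ ≡ true → c ≢ c′) → (z ≡ false → z′ ≡ false → s ≢ s′) →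
               pick z s c ≢ pick z′ s′ c′
      pick-≢ {true}  {true}                   h _ p = h refl refl (suc-injective (suc-injective p))
      pick-≢ {true}  {false} {s′ = true}      _ _ ()
      pick-≢ {true}  {false} {s′ = false}     _ _ ()
      pick-≢ {false} {true}  {true}           _ _ ()
      pick-≢ {false} {true}  {false}          _ _ ()
      pick-≢ {false} {false} {true}  {true}   _ h _ = h refl refl refl
      pick-≢ {false} {false} {true}  {false}  _ _ ()
      pick-≢ {false} {false} {false} {true}   _ _ ()
      pick-≢ {false} {false} {false} {false}  _ h _ = h refl refl refl

      colour-proper : ∀ {u u′} → u ∈ W → u′ ∈ W → adj G u u′ ≡ true → colour u ≢ colour u′
      colour-proper u∈W u′∈W e =
        pick-≢ (λ p q → col-proper p q e) (λ p q → proper T u∈W p u′∈W q e)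

    colour-sides : ∀ {W Z} → Transversal W Z → (∀ u → u ∉ Z) → ColourableOn W 2
    colour-sides T Z=∅ = pick ∘ side T , λ {u} {u′} u∈W u′∈W e →
      proper T u∈W (Z=∅ u) u′∈W (Z=∅ u′) e ∘ pick-injective
      where
      pick : Bool → Fin 2
      pick true  = fzero
      pick false = fsuc fzero

      pick-injective : ∀ {s s′} → pick s ≡ pick s′ → s ≡ s′
      pick-injective {true}  {true}  _ = refl
      pick-injective {false} {false} _ = refl

    -- Used to decide between large spheres at every radius and a smaller transversal coming from
    -- some radius.
    all-or-one : ∀ {P : ℕ → Set} {R : Set} m → (∀ i → i < m → P i ⊎ R) → (∀ i → i < m → P i) ⊎ R
    all-or-one zero    h = inj₁ λ _ ()
    all-or-one (suc m) h with h m ≤-refl | all-or-one m (λ i i<m → h i (m≤n⇒m≤1+n i<m))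
    ... | inj₂ r | _      = inj₂ r
    ... | _      | inj₂ r = inj₂ r
    ... | inj₁ p | inj₁ f = inj₁ λ i i<1+m → case-< i (m<1+n⇒m<n∨m≡n i<1+m)
      where
      case-< : ∀ i → (i < m) ⊎ (i ≡ m) → _
      case-< i (inj₁ i<m)  = f i i<m
      case-< i (inj₂ refl) = p

    LargeBalls : VSet n → ℕ → Set
    LargeBalls W g = Σ (Fin n) λ v → v ∈ W × ∀ i → i ≤ k → ballBound i g ≤ card (ball W v i)

    large-spheres⇒large-balls : ∀ {W v g} → (∀ i → i < k → sphereBound i g ≤ card (sphere W v i)) →
                                ∀ i → i ≤ k → ballBound i g ≤ card (ball W v i)
    large-spheres⇒large-balls {W} {v} h zero    _   = card-≥1 {P = ball W v 0} {v} (ball-center W v 0)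
    large-spheres⇒large-balls {W} {v} h (suc i) i<k = ≤-trans
      (+-mono-≤ (large-spheres⇒large-balls h i (<⇒≤ i<k)) (h i i<k))
      (card-ball-suc W v i)

    mutual
      -- The outer induction is on `g`: `centre` at `suc g` applies `large-balls g` to the
      -- transversal. The descent starts from `W` as its own transversal, where nothing is left to
      -- colour and any `side` will do.
      large-balls : ∀ g W → ¬ ColourableOn W (suc g * 2) → LargeBalls W g
      large-balls g W ¬col = descent g W ¬col (card W) W ≤-refl
        (mkTransversal (λ _ h → h) (λ _ → false) (λ u∈W u∉W → true≢false u∈W u∉W))

      -- The number `m` bounds `card Z` and drops with each smaller transversal, so the search ends
      -- at one whose spheres are all large.
      descent : ∀ g W → ¬ ColourableOn W (suc g * 2) →
                ∀ m Z → card Z ≤ m → Transversal W Z → LargeBalls W g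
      descent g W ¬col m Z Z≤m T with centre g T ¬col
      ... | v , v∈Z , v-large
          with all-or-one k (λ i → sphere-large-or-smaller T v∈Z {i})
      ...   | inj₁ spheres = v , within T v v∈Z , large-spheres⇒large-balls λ i i<k →
                v-large i i<k (spheres i i<k)
      ...   | inj₂ (Z′ , Z′<Z , T′) with m | ≤-trans Z′<Z Z≤m
      ...     | suc m′ | s≤s Z′≤m′ = descent g W ¬col m′ Z′ Z′≤m′ T′

      -- The vertex is chosen before its spheres are known to be large, so the bound is conditional.
      -- For `g = 0` any vertex of `Z` works; otherwise a ball inside `Z` lies in
      -- `Z ∩ ball W v (suc i)`, which the sphere outnumbers or equals.
      centre : ∀ g {W Z} → Transversal W Z → ¬ ColourableOn W (suc g * 2) →
               Σ (Fin n) λ v → v ∈ Z × ∀ i → i < k →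
               card (Z ∩ ball W v (suc i)) ≤ card (sphere W v i) × 2 ≤ card (sphere W v i) →
               sphereBound i g ≤ card (sphere W v i)
      centre zero {W} {Z} T ¬col with any? (λ v → Z v ≟ᵇ true)
      ... | yes (v , v∈Z) = v , v∈Z , λ _ _ → proj₂
      ... | no  Z=∅       = ⊥-elim (¬col (colour-sides T λ u → ¬-not λ u∈Z → Z=∅ (u , u∈Z)))
      centre (suc g) {W} {Z} T ¬col =
        let v , v∈Z , balls = large-balls g Z (¬col ∘ colour-transversal T)
        in v , v∈Z , λ i i<k (Z∩B≤S , _) →
             ≤-trans (balls (suc i) i<k)
               (≤-trans (card-mono λ u h → ∧-intro (ball⊆ v∈Z (suc i) u h) (ball-mono (within T) v (suc i) u h)) Z∩B≤S)

-- From the chromatic number to the vertex bound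

mainTheorem1 : (k : ℕ) → 1 ≤ k → (n : ℕ) → 1 ≤ n → (G : SimpleGraph n)
    → OddGirthAtLeast G (2 * k + 1) → (χ : ℕ) → IsChromaticNumber G χ
    → bound k χ ≤ n
mainTheorem1 (suc k) _ n 1≤n G og χ (_ , χ-min) = main ((χ ∸ 1) / 2) refl
  where
  main : ∀ f → (χ ∸ 1) / 2 ≡ f → 2 * ((k + f) C k) + ((k + f) C suc k) ∸ 1 ≤ n
  -- Here the bound is `2 * 1 + 0 - 1 = 1`, so a nonempty vertex set suffices.
  main zero _ rewrite +-identityʳ k | nCn≡1 k | k>n⇒nCk≡0 (n<1+n k) = 1≤n
  main (suc g) eq =
    let v , _ , balls = large-balls G og g (λ _ → true) ¬colourable
    in begin
      2 * ((k + suc g) C k) + ((k + suc g) C suc k) ∸ 1 ≤⟨ m∸n≤m _ 1 ⟩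
      2 * ((k + suc g) C k) + ((k + suc g) C suc k)     ≡⟨ ballBound-binomial k g ⟩
      ballBound (suc k) g                               ≤⟨ balls (suc k) ≤-refl ⟩
      card (ball G (λ _ → true) v (suc k))              ≤⟨ card≤n (ball G (λ _ → true) v (suc k)) ⟩
      n                                                 ∎
    where
    open ≤-Reasoning
    f*2≤χ∸1 : suc g * 2 ≤ χ ∸ 1
    f*2≤χ∸1 = subst (λ f → f * 2 ≤ χ ∸ 1) eq (m/n*n≤m (χ ∸ 1) 2)

    ≤∸1⇒< : ∀ {m x} → suc m ≤ x ∸ 1 → suc m < x
    ≤∸1⇒< {x = suc x} p = s≤s p

    -- Twice the floor of `(χ - 1) / 2` is at most `χ - 1`, so this many colours contradicts the
    -- minimality of `χ`.
    ¬colourable : ¬ ColourableOn G (λ _ → true) (suc g * 2)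
    ¬colourable (col , col-proper) =
      <⇒≱ (≤∸1⇒< f*2≤χ∸1) (χ-min (suc g * 2) (col , λ u u′ → col-proper refl refl))
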